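{- Let $G$ be a block graph and let $k\ge 0$ be an integer. Then $\ddot{\gamma}_P^k(G)=(k+1)\gamma_P(G)$.
   Context: All graphs are finite, simple, undirected, with nonempty vertex set. A block of a connected graph $G$ is a maximal connected induced subgraph of $G$ that has no cut-vertex (of itself). A block graph is a connected graph in which every block is a complete graph. For $S\subseteq V(G)$ the power domination process is: (1) start with the observed set $N[S]$ (the union of closed neighborhoods of vertices of $S$); (2) while some observed vertex has exactly one unobserved neighbor $w$, add $w$ to the observed set. $S$ is a power dominating set if eventually all vertices are observed. $\gamma_P(G)$ is the minimum cardinality of a power dominating set. For an integer $k\ge 0$, a multiset $S$ of vertices of $G$ is a $k$-PMU-defect-robust power dominating set ($k$-rPDS) if $|S|\ge k$ and for every submultiset $F$ of $S$ with $|F|=k$, the underlying set of $S\setminus F$ (multiset difference) contains a power dominating set of $G$. Cardinalities of multisets count multiplicity. $\ddot{\gamma}_P^k(G)$ is the minimum cardinality of a $k$-rPDS of $G$. -}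

module Defs where

open import Data.Fin.Base using (Fin)
open import Data.Fin.Properties using (_≟_; any?; all?)
open import Data.Fin.Subset
  using (Subset; _∈_; _∉_; _⊆_; _⊃_; _∪_; _-_; ⁅_⁆; ⊤; ∣_∣; Nonempty)
open import Data.Fin.Subset.Induction using (⊃-wellFounded; Acc; acc)
open import Data.Fin.Subset.Properties
  using (_∈?_; _⊆?_; ∈⊤; ⊆⊤; ⊆-antisym; p⊆p∪q; x∈p∪q⁺; x∈p∪q⁻; x∈⁅x⁆; x∈⁅y⁆⇒x≡y; anySubset?)
open import Data.Nat.Base using (ℕ; suc; _∸_; _≤_; _<_; NonZero; s≤s; s≤s⁻¹)
open import Data.Nat.Properties
  using (_≤?_; _<?_; ≤-refl; ≤-reflexive; ≤-trans; n≤1+n; m≤m+n; m≤n+m; m<n⇒0<n∸m; ≮⇒≥; anyUpTo?)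
  renaming (_≟_ to _≟ℕ_)
open import Data.Nat.Induction using (<-wellFounded)
open import Data.Product.Base using (∃; ∃₂; _×_; _,_; proj₁; proj₂)
open import Data.Sum.Base using (_⊎_; inj₁; inj₂)
open import Data.Vec.Base using (Vec; []; _∷_; lookup; replicate; sum; tabulate; zipWith)
open import Data.Vec.Properties
  using (lookup∘tabulate; []=⇒lookup; lookup⇒[]=; lookup-zipWith; lookup-replicate)
open import Data.Vec.Relation.Binary.Pointwise.Inductive as Pointwise using (Pointwise; []; _∷_)
open import Function.Base using (_∘_)
open import Level using (0ℓ)
open import Relation.Binary.Core using (Rel)
open import Relation.Binary.Construct.Closure.ReflexiveTransitive using (Star; ε; _◅_)
import Relation.Binary.Definitions as Binary
open import Relation.Binary.PropositionalEquality using (_≡_; _≢_; refl; trans; subst)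
open import Relation.Nullary using (¬_; Dec; yes; no)
open import Relation.Nullary.Decidable
  using (does; map′; ¬?; _×-dec_; _⊎-dec_; _→-dec_; dec-true; decidable-stable)
open import Relation.Unary using (Pred; Decidable)

record Graph : Set₁ where
  infix 4 _~_ _~?_
  field
    order    : ℕ
    nonempty : NonZero order
    _~_      : Rel (Fin order) 0ℓ
    _~?_     : Binary.Decidable _~_
    ~-sym    : Binary.Symmetric _~_
    ~-irrefl : Binary.Irreflexive _≡_ _~_

  Vertex : Set
  Vertex = Fin order

module _ (G : Graph) where
  open Graph G

  -- A vertex subset B stands for the subgraph of G induced by B; a walk
  -- uses vertices of B only (except that the empty walk exists at any vertex).
  Walk : Subset order → Rel Vertex 0ℓ
  Walk B = Star (λ u v → u ∈ B × v ∈ B × u ~ v)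

  Connected : Pred (Subset order) 0ℓ
  Connected B = Nonempty B × (∀ {u v} → u ∈ B → v ∈ B → Walk B u v)

  -- Deleting v separates two other vertices of B that were joined in B.
  CutVertex : Subset order → Pred Vertex 0ℓ
  CutVertex B v = v ∈ B × ∃₂ λ x y →
    x ∈ B - v × y ∈ B - v × Walk B x y × ¬ Walk (B - v) x y

  ConnectedWithoutCutVertex : Pred (Subset order) 0ℓ
  ConnectedWithoutCutVertex B = Connected B × (∀ v → ¬ CutVertex B v)

  Block : Pred (Subset order) 0ℓ
  Block B = ConnectedWithoutCutVertex B ×
    (∀ C → ConnectedWithoutCutVertex C → B ⊆ C → C ⊆ B)

  Complete : Pred (Subset order) 0ℓ
  Complete B = ∀ {u v} → u ∈ B → v ∈ B → u ≢ v → u ~ v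

  BlockGraph : Set
  BlockGraph = Connected ⊤ × (∀ B → Block B → Complete B)

module _ (G : Graph) where
  open Graph G

  inN? : ∀ S v → Dec (∃ λ s → s ∈ S × (v ≡ s ⊎ v ~ s))
  inN? S v = any? λ s → (s ∈? S) ×-dec ((v ≟ s) ⊎-dec (v ~? s))

  N[_] : Subset order → Subset order
  N[ S ] = tabulate (λ v → does (inN? S v))

  -- A is the current set of observed vertices.
  Forces : Subset order → Vertex → Vertex → Set
  Forces A v w = v ∈ A × v ~ w × w ∉ A × (∀ u → v ~ u → u ∉ A → u ≡ w)

  infix 4 _⟶_
  _⟶_ : Rel (Subset order) 0ℓ
  A ⟶ B = ∃₂ λ v w → Forces A v w × B ≡ A ∪ ⁅ w ⁆

  PowerDominating : Pred (Subset order) 0ℓ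
  PowerDominating S = Star _⟶_ N[ S ] ⊤

-- A multiset of elements of Fin n is the vector of its multiplicities.
Multiset : ℕ → Set
Multiset = Vec ℕ

infix 4 _⊑_
_⊑_ : ∀ {n} → Rel (Multiset n) 0ℓ
_⊑_ = Pointwise _≤_

infixl 5 _∖_
_∖_ : ∀ {n} → Multiset n → Multiset n → Multiset n
_∖_ = zipWith _∸_

card : ∀ {n} → Multiset n → ℕ
card = sum

support : ∀ {n} → Multiset n → Subset n
support M = tabulate (λ v → does (0 <? lookup M v))

module _ (G : Graph) where
  open Graph G

  ContainsPowerDominating : Pred (Subset order) 0ℓ
  ContainsPowerDominating T = ∃ λ P → PowerDominating G P × P ⊆ T

  RobustPowerDominating : ℕ → Pred (Multiset order) 0ℓ
  RobustPowerDominating k S = k ≤ card S ×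
    (∀ F → F ⊑ S → card F ≡ k → ContainsPowerDominating (support (S ∖ F)))

IsMinimum : {A : Set} → (A → ℕ) → Pred A 0ℓ → Pred ℕ 0ℓ
IsMinimum size P m = (∃ λ a → P a × size a ≡ m) × (∀ a → P a → m ≤ size a)

module _ {A : Set} (size : A → ℕ) {P : Pred A 0ℓ}
         (P? : ∀ m → Dec (∃ λ a → P a × size a ≡ m)) where

  minimum : (∃ λ a → P a) → ∃ (IsMinimum size P)
  minimum (a₀ , p₀) = go a₀ p₀ (<-wellFounded (size a₀))
    where
    go : ∀ a → P a → Acc _<_ (size a) → ∃ (IsMinimum size P)
    go a p (acc rs) with anyUpTo? P? (size a)
    ... | yes (_ , lt , b , q , refl) = go b q (rs lt)
    ... | no none = size a , (a , p , refl) ,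
          λ b q → ≮⇒≥ λ lt → none (size b , lt , b , q , refl)

module _ (G : Graph) where
  open Graph G

  forces? : ∀ A v w → Dec (Forces G A v w)
  forces? A v w = (v ∈? A) ×-dec (v ~? w) ×-dec ¬? (w ∈? A) ×-dec
    all? (λ u → (v ~? u) →-dec (¬? (u ∈? A) →-dec (u ≟ w)))

  Stuck : Pred (Subset order) 0ℓ
  Stuck A = ∀ v w → ¬ Forces G A v w

  run : ∀ A → ∃ λ C → Star (_⟶_ G) A C × Stuck C
  run A = go A (⊃-wellFounded A)
    where
    go : ∀ A → Acc _⊃_ A → ∃ λ C → Star (_⟶_ G) A C × Stuck C
    go A (acc rs) with any? (λ v → any? (forces? A v))
    ... | no none = A , ε , λ v w f → none (v , w , f)
    ... | yes (v , w , f@(_ , _ , w∉A , _))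
        with go (A ∪ ⁅ w ⁆) (rs (p⊆p∪q ⁅ w ⁆ , w , x∈p∪q⁺ (inj₂ (x∈⁅x⁆ w)) , w∉A))
    ...   | C , steps , stuck = C , (v , w , f , refl) ◅ steps , stuck

  stuck-⊆ : ∀ {A B C} → Stuck C → Star (_⟶_ G) A B → A ⊆ C → B ⊆ C
  stuck-⊆ stuck ε A⊆C = A⊆C
  stuck-⊆ {A} {_} {C} stuck ((v , w , (v∈A , v~w , _ , only-w) , refl) ◅ steps) A⊆C =
    stuck-⊆ stuck steps A∪w⊆C
    where
    w∈C : w ∈ C
    w∈C = decidable-stable (w ∈? C) λ w∉C →
      stuck v w (A⊆C v∈A , v~w , w∉C , λ u v~u u∉C → only-w u v~u (u∉C ∘ A⊆C))

    A∪w⊆C : A ∪ ⁅ w ⁆ ⊆ C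
    A∪w⊆C x∈ with x∈p∪q⁻ A ⁅ w ⁆ x∈
    ... | inj₁ x∈A = A⊆C x∈A
    ... | inj₂ x∈w rewrite x∈⁅y⁆⇒x≡y w x∈w = w∈C

  ⟶-⊆ : ∀ {A B} → Star (_⟶_ G) A B → A ⊆ B
  ⟶-⊆ ε x∈A = x∈A
  ⟶-⊆ ((_ , w , _ , refl) ◅ steps) x∈A = ⟶-⊆ steps (p⊆p∪q ⁅ w ⁆ x∈A)

  -- Runs are confluent, so the outcome of one greedy run decides the matter.
  powerDominating? : Decidable (PowerDominating G)
  powerDominating? S with run (N[_] G S)
  ... | C , steps , stuck with ⊤ ⊆? C
  ...   | yes ⊤⊆C = yes (subst (Star (_⟶_ G) _) (⊆-antisym ⊆⊤ ⊤⊆C) steps)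
  ...   | no ⊤⊈C = no λ pd → ⊤⊈C (stuck-⊆ stuck pd (⟶-⊆ steps))

  containsPowerDominating? : Decidable (ContainsPowerDominating G)
  containsPowerDominating? T = anySubset? λ P → powerDominating? P ×-dec (P ⊆? T)

  ⊤-powerDominating : PowerDominating G ⊤
  ⊤-powerDominating = subst (Star (_⟶_ G) _) (⊆-antisym ⊆⊤ ⊤⊆N) ε
    where
    ⊤⊆N : ⊤ ⊆ N[_] G ⊤
    ⊤⊆N {v} _ = lookup⇒[]= v _
      (trans (lookup∘tabulate _ v) (dec-true (inN? G ⊤ v) (v , ∈⊤ , inj₁ refl)))

any⊑? : ∀ {n} {P : Pred (Multiset n) 0ℓ} → Decidable P →
        ∀ S → Dec (∃ λ F → F ⊑ S × P F)
any⊑? P? [] = map′ (λ p → [] , [] , p) (λ { ([] , [] , p) → p }) (P? [])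
any⊑? P? (s ∷ S) = map′
  (λ { (x , x<1+s , F , F⊑S , p) → x ∷ F , s≤s⁻¹ x<1+s ∷ F⊑S , p })
  (λ { (x ∷ F , x≤s ∷ F⊑S , p) → x , s≤s x≤s , F , F⊑S , p })
  (anyUpTo? (λ x → any⊑? (P? ∘ (x ∷_)) S) (suc s))

all⊑? : ∀ {n} {P : Pred (Multiset n) 0ℓ} → Decidable P →
        ∀ S → Dec (∀ F → F ⊑ S → P F)
all⊑? P? S = map′
  (λ none F F⊑S → decidable-stable (P? F) λ ¬p → none (F , F⊑S , ¬p))
  (λ all → λ { (F , F⊑S , ¬p) → ¬p (all F F⊑S) })
  (¬? (any⊑? (¬? ∘ P?) S))

⊑-replicate-card : ∀ {n c} (F : Multiset n) → card F ≤ c → F ⊑ replicate n c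
⊑-replicate-card []      _ = []
⊑-replicate-card (x ∷ F) h =
  ≤-trans (m≤m+n x (card F)) h ∷ ⊑-replicate-card F (≤-trans (m≤n+m (card F) x) h)

module _ (G : Graph) (k : ℕ) where
  open Graph G

  robust? : Decidable (RobustPowerDominating G k)
  robust? S = (k ≤? card S) ×-dec
    all⊑? (λ F → (card F ≟ℕ k) →-dec containsPowerDominating? G (support (S ∖ F))) S

  robust-exists : ∃ (RobustPowerDominating G k)
  robust-exists = S , k≤card order nonempty , λ F _ eq → ⊤ , ⊤-powerDominating G ,
      λ {v} _ → lookup⇒[]= v _ (trans (lookup∘tabulate _ v) (dec-true (0 <? _) (left F eq v)))
    where
    S = replicate order (suc k)

    k≤card : ∀ n → NonZero n → k ≤ card (replicate n (suc k))
    k≤card (suc n) _ = ≤-trans (n≤1+n k) (m≤m+n (suc k) _)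

    left : ∀ F → card F ≡ k → ∀ v → 0 < lookup (S ∖ F) v
    left F eq v rewrite lookup-zipWith _∸_ v S F | lookup-replicate v (suc k) =
      m<n⇒0<n∸m (s≤s (subst (lookup F v ≤_) (lookup-replicate v k)
        (Pointwise.lookup (⊑-replicate-card F (≤-reflexive eq)) v)))

-- Abstract only so that the searches never unfold; the types determine γP and γrP.
abstract

  γP-exists : ∀ G → ∃ (IsMinimum ∣_∣ (PowerDominating G))
  γP-exists G = minimum ∣_∣
    (λ m → anySubset? λ S → powerDominating? G S ×-dec (∣ S ∣ ≟ℕ m))
    (⊤ , ⊤-powerDominating G)

  γrP-exists : ∀ k G → ∃ (IsMinimum card (RobustPowerDominating G k))
  γrP-exists k G = minimum card
    (λ m → map′ (λ { (S , _ , p) → S , p })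
                (λ { (S , p , refl) → S , ⊑-replicate-card S ≤-refl , p , refl })
                (any⊑? (λ S → robust? G k S ×-dec (card S ≟ℕ m)) (replicate _ m)))
    (robust-exists G k)

γP : Graph → ℕ
γP G = proj₁ (γP-exists G)

γrP : ℕ → Graph → ℕ
γrP k G = proj₁ (γrP-exists k G)

{-# OPTIONS --safe #-}
module Submission where

open import Defs
open import Data.Bool.Base using (true; false; if_then_else_)
open import Data.Empty using (⊥-elim)
open import Data.Fin.Base using (Fin)
open import Data.Fin.Properties using (_≟_; any?; all?)
open import Data.Fin.Subset
  using (Subset; _∈_; _∉_; _⊆_; _⊂_; _⊃_; _∪_; _∩_; _─_; _-_; ∁; ⁅_⁆; ⊤; ⊥; ∣_∣; Nonempty)
open import Data.Fin.Subset.Induction using (⊂-wellFounded; ⊃-wellFounded; Acc; acc)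
open import Data.Fin.Subset.Properties
  using (_∈?_; ∈⊤; ⊆⊤; ∉⊥; ⊆-antisym; p⊆p∪q; q⊆p∪q; x∈p∪q⁻; x∈p∩q⁺; x∈p∩q⁻; x∈⁅x⁆; x∈⁅y⁆⇒x≡y;
         x∈∁p⇒x∉p; x∉p⇒x∈∁p; x∉∁p⇒x∈p; p─q⊆p; x∈p∧x≢y⇒x∈p-y; ∣⊥∣≡0; ∣⁅x⁆∣≡1; x∈p⇒∣p-x∣<∣p∣;
         nonempty?; anySubset?)
open import Data.Nat.Base using (ℕ; suc; _+_; _*_; _∸_; _⊓_; _≤_; _<_; z≤n; s≤s)
open import Data.Nat.Properties hiding (_≟_)
open import Algebra.Properties.CommutativeSemigroup +-commutativeSemigroup using (x∙yz≈y∙xz)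
open import Data.Product.Base using (∃; _×_; _,_; proj₁; proj₂)
open import Data.Sum.Base using (_⊎_; inj₁; inj₂)
open import Data.Vec.Base using ([]; _∷_; here; there; lookup; replicate; tabulate; zipWith)
open import Data.Vec.Properties
  using (lookup∘tabulate; []=⇒lookup; lookup⇒[]=; lookup-replicate; lookup-zipWith)
open import Data.Vec.Relation.Binary.Pointwise.Inductive as Pointwise using ([]; _∷_)
open import Function.Base using (_∘_)
open import Level using (0ℓ)
open import Relation.Binary.Construct.Closure.ReflexiveTransitive as Star using (Star; ε; _◅_; _◅◅_)
open import Relation.Binary.Core using (Rel)
open import Relation.Binary.PropositionalEquality
  using (_≡_; _≢_; refl; sym; trans; cong; subst)
open import Relation.Nullary using (¬_; Dec; yes; no)
open import Relation.Nullary.Decidable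
  using (does; map′; ¬?; _×-dec_; _⊎-dec_; _→-dec_; dec-true; decidable-stable)
open import Relation.Unary using (Pred; Decidable)

-- A fort is a nonempty vertex set F such that no vertex outside F has exactly one neighbour
-- in F; a set is power dominating iff it meets the closed neighbourhood N[F] of every fort F.
-- A k-robust multiset has at least k + 1 elements, with multiplicity, in each N[F], so the
-- lower bound follows from a packing of γP forts with pairwise disjoint N[F]. It is found
-- greedily. Root the graph: a region D with top g can be left only through g. As long as S
-- is not power dominating, take a smallest region D containing N[F] for some fort F that
-- avoids S, and add its top g to S. A later fort F′ has g ∉ N[F′], so if it meets D, it
-- does so in the part beyond a neighbour c of g that cuts this part off; in a block graph
-- the other neighbours of c outside that part are adjacent to g, hence not in F′, so that F′
-- restricted to the part is again a fort, against the minimality of D.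

-- Subsets of a finite set.

module _ {n : ℕ} {P : Pred (Fin n) 0ℓ} (P? : Decidable P) where

  ∈-tabulate⁺ : ∀ {x} → P x → x ∈ tabulate (does ∘ P?)
  ∈-tabulate⁺ {x} px = lookup⇒[]= x _ (trans (lookup∘tabulate _ x) (dec-true (P? x) px))

  ∈-tabulate⁻ : ∀ {x} → x ∈ tabulate (does ∘ P?) → P x
  ∈-tabulate⁻ {x} x∈ with P? x | trans (sym (lookup∘tabulate (does ∘ P?) x)) ([]=⇒lookup x∈)
  ... | yes px | _ = px

x∈p─q⇒x∉q : ∀ {n} {x : Fin n} (p q : Subset n) → x ∈ p ─ q → x ∉ q
x∈p─q⇒x∉q (_ ∷ p) (_ ∷ q) (there x∈) (there x∈q) = x∈p─q⇒x∉q p q x∈ x∈q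

x∈p-y⁻ : ∀ {n} {x y : Fin n} (p : Subset n) → x ∈ p - y → x ∈ p × x ≢ y
x∈p-y⁻ {y = y} p x∈ = p─q⊆p p ⁅ y ⁆ x∈ ,
  λ { refl → x∈p─q⇒x∉q p ⁅ y ⁆ x∈ (x∈⁅x⁆ y) }

x∈⊤-y : ∀ {n} {x y : Fin n} → x ≢ y → x ∈ ⊤ - y
x∈⊤-y = x∈p∧x≢y⇒x∈p-y ∈⊤

x∉p⇒p⊂p∪⁅x⁆ : ∀ {n} {x : Fin n} (p : Subset n) → x ∉ p → p ⊂ p ∪ ⁅ x ⁆
x∉p⇒p⊂p∪⁅x⁆ {x = x} p x∉p = p⊆p∪q ⁅ x ⁆ , x , q⊆p∪q p ⁅ x ⁆ (x∈⁅x⁆ x) , x∉p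

Disjoint : ∀ {n} → Rel (Subset n) 0ℓ
Disjoint p q = ∀ {x} → x ∈ p → x ∉ q

disjoint? : ∀ {n} (p q : Subset n) → Dec (Disjoint p q)
disjoint? p q = map′ (λ f {x} → f x) (λ f x → f) (all? λ x → (x ∈? p) →-dec ¬? (x ∈? q))

Disjoint-∪ʳ : ∀ {n} {p : Subset n} (q r : Subset n) → Disjoint p q → Disjoint p r → Disjoint p (q ∪ r)
Disjoint-∪ʳ q r p∩q p∩r x∈p x∈q∪r with x∈p∪q⁻ q r x∈q∪r
... | inj₁ x∈q = p∩q x∈p x∈q
... | inj₂ x∈r = p∩r x∈p x∈r

∣p∪q∣≤∣p∣+∣q∣ : ∀ {n} (p q : Subset n) → ∣ p ∪ q ∣ ≤ ∣ p ∣ + ∣ q ∣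
∣p∪q∣≤∣p∣+∣q∣ [] [] = z≤n
∣p∪q∣≤∣p∣+∣q∣ (true  ∷ p) (true  ∷ q) =
  s≤s (≤-trans (∣p∪q∣≤∣p∣+∣q∣ p q) (+-monoʳ-≤ ∣ p ∣ (n≤1+n ∣ q ∣)))
∣p∪q∣≤∣p∣+∣q∣ (true  ∷ p) (false ∷ q) = s≤s (∣p∪q∣≤∣p∣+∣q∣ p q)
∣p∪q∣≤∣p∣+∣q∣ (false ∷ p) (true  ∷ q) =
  ≤-trans (s≤s (∣p∪q∣≤∣p∣+∣q∣ p q)) (≤-reflexive (sym (+-suc ∣ p ∣ ∣ q ∣)))
∣p∪q∣≤∣p∣+∣q∣ (false ∷ p) (false ∷ q) = ∣p∪q∣≤∣p∣+∣q∣ p q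

-- Multisets and their submultisets.

restrict : ∀ {n} → Subset n → Multiset n → Multiset n
restrict = zipWith λ b m → if b then m else 0

restrict-⊑ : ∀ {n} (p : Subset n) M → restrict p M ⊑ M
restrict-⊑ []          []      = []
restrict-⊑ (true ∷ p)  (m ∷ M) = ≤-refl ∷ restrict-⊑ p M
restrict-⊑ (false ∷ p) (m ∷ M) = z≤n ∷ restrict-⊑ p M

lookup-restrict : ∀ {n x} {p : Subset n} M → x ∈ p → lookup (restrict p M) x ≡ lookup M x
lookup-restrict (m ∷ M) here = refl
lookup-restrict (m ∷ M) (there x∈p) = lookup-restrict M x∈p

card-restrict-replicate : ∀ {n} c (p : Subset n) → card (restrict p (replicate n c)) ≡ c * ∣ p ∣
card-restrict-replicate c [] = sym (*-zeroʳ c)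
card-restrict-replicate c (true ∷ p) =
  trans (cong (c +_) (card-restrict-replicate c p)) (sym (*-suc c ∣ p ∣))
card-restrict-replicate c (false ∷ p) = card-restrict-replicate c p

card-restrict-∪ : ∀ {n} (p q : Subset n) M → Disjoint p q →
                  card (restrict (p ∪ q) M) ≡ card (restrict p M) + card (restrict q M)
card-restrict-∪ [] [] [] _ = refl
card-restrict-∪ (true ∷ p) (true ∷ q) (m ∷ M) p∩q = ⊥-elim (p∩q here here)
card-restrict-∪ (true ∷ p) (false ∷ q) (m ∷ M) p∩q =
  trans (cong (m +_) (card-restrict-∪ p q M λ x∈p x∈q → p∩q (there x∈p) (there x∈q)))
        (sym (+-assoc m _ _))
card-restrict-∪ (false ∷ p) (true ∷ q) (m ∷ M) p∩q =
  trans (cong (m +_) (card-restrict-∪ p q M λ x∈p x∈q → p∩q (there x∈p) (there x∈q)))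
        (x∙yz≈y∙xz m (card (restrict p M)) _)
card-restrict-∪ (false ∷ p) (false ∷ q) (m ∷ M) p∩q =
  card-restrict-∪ p q M λ x∈p x∈q → p∩q (there x∈p) (there x∈q)

card-mono : ∀ {n} {A B : Multiset n} → A ⊑ B → card A ≤ card B
card-mono []        = z≤n
card-mono (a ∷ A⊑B) = +-mono-≤ a (card-mono A⊑B)

-- This turns a light submultiset into an admissible deletion of exactly `k` elements.
⊑-interpolate : ∀ {n} {A M : Multiset n} {k} → A ⊑ M → card A ≤ k → k ≤ card M →
                ∃ λ F → A ⊑ F × F ⊑ M × card F ≡ k
⊑-interpolate [] _ k≤0 = [] , [] , [] , sym (n≤0⇒n≡0 k≤0)
⊑-interpolate {A = a ∷ A} {m ∷ M} {k} (a≤m ∷ A⊑M) A≤k k≤M =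
  let F , A⊑F , F⊑M , eq = ⊑-interpolate A⊑M A≤k∸f k∸f≤M
  in f ∷ F , ⊓-glb a≤m (m+n≤o⇒m≤o∸n a A≤k) ∷ A⊑F , m⊓n≤m m _ ∷ F⊑M ,
     trans (cong (f +_) eq) (m+[n∸m]≡n (≤-trans f≤ (m∸n≤m k (card A))))
  where
  -- The head takes as much as it can while `card A` stays reserved for the tail.
  f = m ⊓ (k ∸ card A)

  A≤k′ : card A ≤ k
  A≤k′ = ≤-trans (m≤n+m _ a) A≤k

  f≤ : f ≤ k ∸ card A
  f≤ = m⊓n≤n m _

  A≤k∸f : card A ≤ k ∸ f
  A≤k∸f = ≤-trans (≤-reflexive (sym (m∸[m∸n]≡n A≤k′))) (∸-monoʳ-≤ k f≤)

  k∸f≤M : k ∸ f ≤ card M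
  k∸f≤M with ⊓-sel m (k ∸ card A)
  ... | inj₁ f≡m rewrite f≡m = m≤n+o⇒m∸n≤o k m k≤M
  ... | inj₂ f≡ rewrite f≡ = ≤-trans (≤-reflexive (m∸[m∸n]≡n A≤k′)) (card-mono A⊑M)

-- Closed neighbourhoods and reachability by walks.

module _ (G : Graph) where
  open Graph G

  private
    N : Subset order → Subset order
    N = N[_] G

  x∈N⁺ : ∀ {S x s} → s ∈ S → x ≡ s ⊎ x ~ s → x ∈ N S
  x∈N⁺ {S} s∈S x≈s = ∈-tabulate⁺ (inN? G S) (_ , s∈S , x≈s)

  x∈N⁻ : ∀ {S x} → x ∈ N S → ∃ λ s → s ∈ S × (x ≡ s ⊎ x ~ s)
  x∈N⁻ {S} = ∈-tabulate⁻ (inN? G S)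

  S⊆N : ∀ {S} → S ⊆ N S
  S⊆N x∈S = x∈N⁺ x∈S (inj₁ refl)

  Walk-mono : ∀ {B C u v} → B ⊆ C → Walk G B u v → Walk G C u v
  Walk-mono B⊆C = Star.map λ (u∈B , v∈B , u~v) → B⊆C u∈B , B⊆C v∈B , u~v

  Walk-sym : ∀ {B u v} → Walk G B u v → Walk G B v u
  Walk-sym = Star.reverse λ (u∈B , v∈B , u~v) → v∈B , u∈B , ~-sym u~v

  -- Closure under the edges of `B` makes `R` exactly the set of vertices with a walk to `g`, so
  -- membership in `R` decides walks.
  Reach : Subset order → Vertex → Subset order → Set
  Reach B g R = g ∈ R × (∀ {z} → z ∈ R → Walk G B z g) ×
    (∀ {u v} → u ∈ B × v ∈ B × u ~ v → v ∈ R → u ∈ R)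

  reach : ∀ B g → ∃ (Reach B g)
  reach B g = go ⁅ g ⁆ (⊃-wellFounded _) (x∈⁅x⁆ g)
    λ z∈ → subst (λ z → Walk G B z g) (sym (x∈⁅y⁆⇒x≡y g z∈)) ε
    where
    go : ∀ A → Acc _⊃_ A → g ∈ A → (∀ {z} → z ∈ A → Walk G B z g) → ∃ (Reach B g)
    go A (acc rs) g∈A walk
      with any? (λ u → any? λ v → ((u ∈? B) ×-dec (v ∈? B) ×-dec (u ~? v)) ×-dec
                                   (v ∈? A) ×-dec ¬? (u ∈? A))
    ... | no none = A , g∈A , walk , λ {u} {v} e v∈A →
            decidable-stable (u ∈? A) λ u∉A → none (u , v , e , v∈A , u∉A)
    ... | yes (u , v , e , v∈A , u∉A) =
            go (A ∪ ⁅ u ⁆) (rs (x∉p⇒p⊂p∪⁅x⁆ A u∉A)) (p⊆p∪q ⁅ u ⁆ g∈A) walk′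
      where
      walk′ : ∀ {z} → z ∈ A ∪ ⁅ u ⁆ → Walk G B z g
      walk′ z∈ with x∈p∪q⁻ A ⁅ u ⁆ z∈
      ... | inj₁ z∈A = walk z∈A
      ... | inj₂ z∈u rewrite x∈⁅y⁆⇒x≡y u z∈u = e ◅ walk v∈A

  walk? : ∀ B u v → Dec (Walk G B u v)
  walk? B u v with reach B v
  ... | R , v∈R , walk , closed with u ∈? R
  ...   | yes u∈R = yes (walk u∈R)
  ...   | no u∉R = no λ w →
            u∉R (Star.fold (λ x y → y ∈ R → x ∈ R) (λ e f → closed e ∘ f) (λ r → r) w v∈R)

  -- Simple paths, cycles and blocks.

  data Path : Vertex → Vertex → Subset order → Set where
    []   : ∀ {g} → Path g g ⁅ g ⁆
    cons : ∀ {x y g A} → x ~ y → x ∉ A → Path y g A → Path x g (A ∪ ⁅ x ⁆)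

  Path-start : ∀ {x g A} → Path x g A → x ∈ A
  Path-start []           = x∈⁅x⁆ _
  Path-start (cons _ _ _) = q⊆p∪q _ _ (x∈⁅x⁆ _)

  Path-end : ∀ {x g A} → Path x g A → g ∈ A
  Path-end []           = x∈⁅x⁆ _
  Path-end (cons _ _ p) = p⊆p∪q _ (Path-end p)

  suffix : ∀ {x z g A} → Path x g A → z ∈ A → ∃ λ A′ → Path z g A′ × A′ ⊆ A
  suffix [] z∈ rewrite x∈⁅y⁆⇒x≡y _ z∈ = _ , [] , λ x∈ → x∈
  suffix (cons {A = A} x~y x∉A p) z∈ with x∈p∪q⁻ A _ z∈
  ... | inj₁ z∈A = let A′ , p′ , A′⊆A = suffix p z∈A in A′ , p′ , p⊆p∪q _ ∘ A′⊆A
  ... | inj₂ z∈x rewrite x∈⁅y⁆⇒x≡y _ z∈x = _ , cons x~y x∉A p , λ x∈ → x∈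

  Path⇒Walk : ∀ {x g A} → Path x g A → Walk G A x g
  Path⇒Walk [] = ε
  Path⇒Walk (cons x~y x∉A p) =
    (q⊆p∪q _ _ (x∈⁅x⁆ _) , p⊆p∪q _ (Path-start p) , x~y) ◅ Walk-mono (p⊆p∪q _) (Path⇒Walk p)

  Path-walk : ∀ {x z g A} → Path x g A → z ∈ A → Walk G A z g
  Path-walk p z∈A = let _ , p′ , A′⊆A = suffix p z∈A in Walk-mono A′⊆A (Path⇒Walk p′)

  Walk⇒Path : ∀ {B x g} → Walk G B x g → x ∈ B → ∃ λ A → Path x g A × A ⊆ B
  Walk⇒Path {B} {x} ε x∈B = ⁅ x ⁆ , [] , λ z∈ → subst (_∈ B) (sym (x∈⁅y⁆⇒x≡y x z∈)) x∈B
  Walk⇒Path {B} {x} ((_ , y∈B , x~y) ◅ w) x∈B with Walk⇒Path w y∈B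
  ... | A , p , A⊆B with x ∈? A
  ...   | yes x∈A = let A′ , p′ , A′⊆A = suffix p x∈A in A′ , p′ , A⊆B ∘ A′⊆A
  ...   | no x∉A = A ∪ ⁅ x ⁆ , cons x~y x∉A p , A∪x⊆B
    where
    A∪x⊆B : A ∪ ⁅ x ⁆ ⊆ B
    A∪x⊆B z∈ with x∈p∪q⁻ A ⁅ x ⁆ z∈
    ... | inj₁ z∈A = A⊆B z∈A
    ... | inj₂ z∈x rewrite x∈⁅y⁆⇒x≡y x z∈x = x∈B

  -- Deleting `v` leaves at most two pieces of the path, each containing an original end. If the
  -- start is `v`, the rest leads to `g`; otherwise a walk to the next vertex extends to `x`.
  Path-delete : ∀ {x g A z} v → Path x g A → z ∈ A - v →
                ∃ λ e → (e ≡ x ⊎ e ≡ g) × e ∈ A - v × Walk G (A - v) z e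
  Path-delete {A = A} {z} v [] z∈ = z , inj₁ (x∈⁅y⁆⇒x≡y _ (proj₁ (x∈p-y⁻ A z∈))) , z∈ , ε
  Path-delete {x} {g} {_} {z} v (cons {y = y} {A = A} x~y x∉A p) z∈
    with x∈p∪q⁻ A ⁅ x ⁆ (proj₁ (x∈p-y⁻ (A ∪ ⁅ x ⁆) z∈))
  ... | inj₂ z∈x = z , inj₁ (x∈⁅y⁆⇒x≡y x z∈x) , z∈ , ε
  ... | inj₁ z∈A with x ≟ v
  ...   | yes refl = g , inj₂ refl , A⊆ (Path-end p) , Walk-mono A⊆ (Path-walk p z∈A)
    where
    A⊆ : A ⊆ (A ∪ ⁅ x ⁆) - x
    A⊆ a∈A = x∈p∧x≢y⇒x∈p-y (p⊆p∪q ⁅ x ⁆ a∈A) λ { refl → x∉A a∈A }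
  ...   | no x≢v with Path-delete v p (x∈p∧x≢y⇒x∈p-y z∈A (proj₂ (x∈p-y⁻ (A ∪ ⁅ x ⁆) z∈)))
  ...     | e , end , e∈ , w = extend end
    where
    A-v⊆ : A - v ⊆ (A ∪ ⁅ x ⁆) - v
    A-v⊆ a∈ = let a∈A , a≢v = x∈p-y⁻ A a∈ in x∈p∧x≢y⇒x∈p-y (p⊆p∪q ⁅ x ⁆ a∈A) a≢v

    x∈ : x ∈ (A ∪ ⁅ x ⁆) - v
    x∈ = x∈p∧x≢y⇒x∈p-y (q⊆p∪q A ⁅ x ⁆ (x∈⁅x⁆ x)) x≢v

    extend : e ≡ y ⊎ e ≡ g → ∃ λ e → (e ≡ x ⊎ e ≡ g) × e ∈ (A ∪ ⁅ x ⁆) - v ×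
                                     Walk G ((A ∪ ⁅ x ⁆) - v) z e
    extend (inj₁ refl) = x , inj₁ refl , x∈ , Walk-mono A-v⊆ w ◅◅ (A-v⊆ e∈ , x∈ , ~-sym x~y) ◅ ε
    extend (inj₂ e≡g) = e , inj₂ e≡g , A-v⊆ e∈ , Walk-mono A-v⊆ w

  -- The path and `c` form a cycle (an edge if `x` is `g`). If `c` is deleted, the path remains; if
  -- another vertex is, every vertex left still reaches an end of the path, hence `c`.
  cycle-connectedWithoutCutVertex : ∀ {c x g A} → Path x g A → c ∉ A → x ~ c → g ~ c →
                                    ConnectedWithoutCutVertex G (A ∪ ⁅ c ⁆)
  cycle-connectedWithoutCutVertex {c} {x} {g} {A} p c∉A x~c g~c =
    ((c , c∈B) , λ u∈ v∈ → toC u∈ ◅◅ Walk-sym (toC v∈)) , noCut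
    where
    B = A ∪ ⁅ c ⁆

    c∈B : c ∈ B
    c∈B = q⊆p∪q A ⁅ c ⁆ (x∈⁅x⁆ c)

    toC : ∀ {u} → u ∈ B → Walk G B u c
    toC u∈ with x∈p∪q⁻ A ⁅ c ⁆ u∈
    ... | inj₁ u∈A = Walk-mono (p⊆p∪q ⁅ c ⁆) (Path-walk p u∈A) ◅◅
                     (p⊆p∪q ⁅ c ⁆ (Path-end p) , c∈B , g~c) ◅ ε
    ... | inj₂ u∈c rewrite x∈⁅y⁆⇒x≡y c u∈c = ε

    A-v⊆B-v : ∀ {v} → A - v ⊆ B - v
    A-v⊆B-v a∈ = let a∈A , a≢v = x∈p-y⁻ A a∈ in x∈p∧x≢y⇒x∈p-y (p⊆p∪q ⁅ c ⁆ a∈A) a≢v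

    end~c : ∀ {e} → e ≡ x ⊎ e ≡ g → e ~ c
    end~c (inj₁ refl) = x~c
    end~c (inj₂ refl) = g~c

    toG : ∀ {u} → u ∈ B - c → Walk G (B - c) u g
    toG u∈ with x∈p-y⁻ B u∈
    ... | u∈B , u≢c with x∈p∪q⁻ A ⁅ c ⁆ u∈B
    ...   | inj₂ u∈c = ⊥-elim (u≢c (x∈⁅y⁆⇒x≡y c u∈c))
    ...   | inj₁ u∈A = Walk-mono (λ a∈A → x∈p∧x≢y⇒x∈p-y (p⊆p∪q ⁅ c ⁆ a∈A) λ { refl → c∉A a∈A })
                                 (Path-walk p u∈A)

    toC-v : ∀ {u v} → v ≢ c → u ∈ B - v → Walk G (B - v) u c
    toC-v {v = v} v≢c u∈ with x∈p-y⁻ B u∈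
    ... | u∈B , u≢v with x∈p∪q⁻ A ⁅ c ⁆ u∈B
    ...   | inj₂ u∈c rewrite x∈⁅y⁆⇒x≡y c u∈c = ε
    ...   | inj₁ u∈A with Path-delete v p (x∈p∧x≢y⇒x∈p-y u∈A u≢v)
    ...     | e , end , e∈ , w = Walk-mono A-v⊆B-v w ◅◅
                (A-v⊆B-v e∈ , x∈p∧x≢y⇒x∈p-y c∈B (v≢c ∘ sym) , end~c end) ◅ ε

    noCut : ∀ v → ¬ CutVertex G B v
    noCut v (_ , _ , _ , u∈ , u′∈ , _ , ¬w) with v ≟ c
    ... | yes refl = ¬w (toG u∈ ◅◅ Walk-sym (toG u′∈))
    ... | no v≢c = ¬w (toC-v v≢c u∈ ◅◅ Walk-sym (toC-v v≢c u′∈))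

  -- If no block contains `A`, then `A` is maximal, since by induction a larger set of this kind
  -- would lie in a block. The double negation avoids deciding maximality and is enough for the
  -- decidable `_~_`.
  ¬¬⊆Block : ∀ {A} → ConnectedWithoutCutVertex G A → ¬ ¬ ∃ λ B → Block G B × A ⊆ B
  ¬¬⊆Block {A} = go A (⊃-wellFounded A)
    where
    go : ∀ A → Acc _⊃_ A → ConnectedWithoutCutVertex G A → ¬ ¬ ∃ λ B → Block G B × A ⊆ B
    go A (acc rs) ccA none = none (A , (ccA , maximal) , λ x∈ → x∈)
      where
      maximal : ∀ C → ConnectedWithoutCutVertex G C → A ⊆ C → C ⊆ A
      maximal C ccC A⊆C {x} x∈C = decidable-stable (x ∈? A) λ x∉A →
        go C (rs (A⊆C , x , x∈C , x∉A)) ccC λ (B , b , C⊆B) → none (B , b , C⊆B ∘ A⊆C)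

  -- A path from x to g avoiding c closes up to a cycle through c, which lies in one block.
  neighbours-adjacent : BlockGraph G → ∀ {c x g} → x ~ c → g ~ c → x ≢ g →
                        Walk G (⊤ - c) x g → x ~ g
  neighbours-adjacent (_ , complete) {c} {x} {g} x~c g~c x≢g w
    with Walk⇒Path w (x∈⊤-y λ x≡c → ~-irrefl x≡c x~c)
  ... | A , p , A⊆ = decidable-stable (x ~? g) λ x≁g →
        ¬¬⊆Block (cycle-connectedWithoutCutVertex p (λ c∈A → proj₂ (x∈p-y⁻ ⊤ (A⊆ c∈A)) refl) x~c g~c)
          λ (B , b , A∪c⊆B) → x≁g (complete B b (A∪c⊆B (p⊆p∪q ⁅ c ⁆ (Path-start p)))
                                                (A∪c⊆B (p⊆p∪q ⁅ c ⁆ (Path-end p))) x≢g)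

  -- Regions and the parts cut off by a vertex.

  Beyond : Vertex → Vertex → Pred Vertex 0ℓ
  Beyond g c z = z ≡ c ⊎ ¬ Walk G (⊤ - c) z g

  beyond? : ∀ g c → Decidable (Beyond g c)
  beyond? g c z = (z ≟ c) ⊎-dec ¬? (walk? (⊤ - c) z g)

  beyond : Vertex → Vertex → Subset order
  beyond g c = tabulate (does ∘ beyond? g c)

  record Region (g : Vertex) (D : Subset order) : Set where
    field
      top∈   : g ∈ D
      closed : ∀ {y z} → y ∈ D → y ≢ g → y ~ z → z ∈ D

  open Region

  -- If a vertex cut off by `c` had a neighbour still joined to `g` off `c`, it would be joined to
  -- `g` off `c` itself.
  beyond-region : ∀ g c → Region c (beyond g c)
  beyond-region g c .top∈ = ∈-tabulate⁺ (beyond? g c) (inj₁ refl)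
  beyond-region g c .closed {y} {z} y∈ y≢c y~z with ∈-tabulate⁻ (beyond? g c) y∈
  ... | inj₁ y≡c = ⊥-elim (y≢c y≡c)
  ... | inj₂ ¬w with z ≟ c
  ...   | yes z≡c = ∈-tabulate⁺ (beyond? g c) (inj₁ z≡c)
  ...   | no z≢c = ∈-tabulate⁺ (beyond? g c) (inj₂ λ w → ¬w ((x∈⊤-y y≢c , x∈⊤-y z≢c , y~z) ◅ w))

  Opposite : Subset order → Rel Vertex 0ℓ
  Opposite D z c = (z ∈ D × c ∉ D) ⊎ (z ∉ D × c ∈ D)

  opposite⇒≢ : ∀ {D z c} → Opposite D z c → z ≢ c
  opposite⇒≢ (inj₁ (z∈ , z∉)) refl = z∉ z∈
  opposite⇒≢ (inj₂ (z∉ , z∈)) refl = z∉ z∈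

  -- A walk to g cannot cross the boundary of D before it reaches g.
  walk-avoiding : ∀ {g D c z} → Region g D → c ≢ g → Opposite D z c →
                  Walk G ⊤ z g → Walk G (⊤ - c) z g
  walk-avoiding r c≢g opp ε = ε
  walk-avoiding {g} {D} {c} {z} r c≢g opp (_◅_ {j = y} (_ , _ , z~y) w) with z ≟ g | y ≟ g
  ... | yes refl | _        = ε
  ... | no _     | yes refl = (x∈⊤-y (opposite⇒≢ opp) , x∈⊤-y (c≢g ∘ sym) , z~y) ◅ ε
  ... | no z≢g   | no y≢g   =
    (x∈⊤-y (opposite⇒≢ opp) , x∈⊤-y (opposite⇒≢ opp′) , z~y) ◅ walk-avoiding r c≢g opp′ w
    where
    move : Opposite D z c → Opposite D y c
    move (inj₁ (z∈ , c∉)) = inj₁ (closed r z∈ z≢g z~y , c∉)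
    move (inj₂ (z∉ , c∈)) = inj₂ ((λ y∈ → z∉ (closed r y∈ y≢g (~-sym z~y))) , c∈)

    opp′ = move opp

  -- A gate `c` for the next vertex `y` also serves `z`, unless `z` reaches `g` off `c`. Then `y`
  -- must be `c`, for otherwise `y` would reach `g` through `z`; so `z` and `g` are neighbours of
  -- `c` joined off `c`, hence adjacent, and `z` is its own gate.
  gate : BlockGraph G → ∀ {g z} → z ≢ g → Walk G ⊤ z g → ∃ λ c → c ~ g × Beyond g c z
  gate bg z≢g ε = ⊥-elim (z≢g refl)
  gate bg {g} {z} z≢g (_◅_ {j = y} (_ , _ , z~y) w) with y ≟ g
  ... | yes refl = z , z~y , inj₁ refl
  ... | no y≢g = let c , c~g , y-beyond = gate bg y≢g w in extend c~g y-beyond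
    where
    extend : ∀ {c} → c ~ g → Beyond g c y → ∃ λ c → c ~ g × Beyond g c z
    extend {c} c~g y-beyond with beyond? g c z | z ≟ c
    ... | yes z-beyond | _ = c , c~g , z-beyond
    ... | no ¬z-beyond | yes z≡c = ⊥-elim (¬z-beyond (inj₁ z≡c))
    ... | no ¬z-beyond | no z≢c with walk? (⊤ - c) z g | y-beyond
    ...   | no ¬w | _ = ⊥-elim (¬z-beyond (inj₂ ¬w))
    ...   | yes w | inj₁ refl = z , neighbours-adjacent bg z~y (~-sym c~g) z≢g w , inj₁ refl
    ...   | yes w | inj₂ ¬w with y ≟ c
    ...     | yes refl = z , neighbours-adjacent bg z~y (~-sym c~g) z≢g w , inj₁ refl
    ...     | no y≢c = ⊥-elim (¬w ((x∈⊤-y y≢c , x∈⊤-y z≢c , ~-sym z~y) ◅ w))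

  -- `escape` serves `fort-∩`: a fort whose closed neighbourhood misses `g` contains no neighbour of
  -- `root` outside `sub`.
  record SubRegion (g : Vertex) (D : Subset order) (y : Vertex) : Set where
    field
      root      : Vertex
      sub       : Subset order
      region    : Region root sub
      root~     : root ~ g
      y∈sub     : y ∈ sub
      g∉sub     : g ∉ sub
      sub⊆      : sub ⊆ D
      escape    : ∀ {z} → root ~ z → z ∉ sub → z ≡ g ⊎ z ~ g

  subRegion : BlockGraph G → ∀ {g D y} → Region g D → y ∈ D → y ≢ g → SubRegion g D y
  subRegion bg@((_ , connected) , _) {g} {D} {y} r y∈D y≢g
    with gate bg y≢g (connected ∈⊤ ∈⊤)
  ... | c , c~g , y-beyond = record
    { root = c ; sub = D′ ; region = beyond-region g c ; root~ = c~g
    ; y∈sub = ∈-tabulate⁺ (beyond? g c) y-beyond ; g∉sub = g∉ ; sub⊆ = D′⊆D ; escape = escape }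
    where
    D′ = beyond g c

    c≢g : c ≢ g
    c≢g c≡g = ~-irrefl c≡g c~g

    g∉ : g ∉ D′
    g∉ g∈ with ∈-tabulate⁻ (beyond? g c) g∈
    ... | inj₁ g≡c = c≢g (sym g≡c)
    ... | inj₂ ¬w = ¬w ε

    -- If `c` lay outside `D`, a walk from `y` to `g` would stay in `D` up to `g` and so miss `c`.
    root∈D : Beyond g c y → c ∈ D
    root∈D (inj₁ refl) = y∈D
    root∈D (inj₂ ¬w) = decidable-stable (c ∈? D) λ c∉D →
      ¬w (walk-avoiding r c≢g (inj₁ (y∈D , c∉D)) (connected ∈⊤ ∈⊤))

    c∈D = root∈D y-beyond

    D′⊆D : D′ ⊆ D
    D′⊆D {z} z∈ with ∈-tabulate⁻ (beyond? g c) z∈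
    ... | inj₁ refl = c∈D
    ... | inj₂ ¬w = decidable-stable (z ∈? D) λ z∉D →
          ¬w (walk-avoiding r c≢g (inj₂ (z∉D , c∈D)) (connected ∈⊤ ∈⊤))

    -- Not being cut off, `z` is `g` or is joined to `g` off their common neighbour `c`.
    escape : ∀ {z} → c ~ z → z ∉ D′ → z ≡ g ⊎ z ~ g
    escape {z} c~z z∉ with z ≟ g | walk? (⊤ - c) z g
    ... | yes z≡g | _     = inj₁ z≡g
    ... | no z≢g  | yes w = inj₂ (neighbours-adjacent bg (~-sym c~z) (~-sym c~g) z≢g w)
    ... | no _    | no ¬w = ⊥-elim (z∉ (∈-tabulate⁺ (beyond? g c) (inj₂ ¬w)))

  -- Forts as obstructions to power domination.

  Fort : Pred (Subset order) 0ℓ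
  Fort F = Nonempty F × (∀ v u → v ∉ F → u ∈ F → v ~ u → ∃ λ u′ → u′ ∈ F × u′ ≢ u × v ~ u′)

  fort? : Decidable Fort
  fort? F = nonempty? F ×-dec all? λ v → all? λ u →
    ¬? (v ∈? F) →-dec ((u ∈? F) →-dec ((v ~? u) →-dec
      any? λ u′ → (u′ ∈? F) ×-dec ¬? (u′ ≟ u) ×-dec (v ~? u′)))

  -- The observed set stays disjoint from `F`: a vertex forcing the first `w` in `F` would lie
  -- outside `F` and have a second neighbour in `F`, also unobserved.
  powerDominating-meets-fort : ∀ {P F} → Fort F → PowerDominating G P → ¬ Disjoint (N F) P
  powerDominating-meets-fort {P} {F} ((f , f∈F) , fort) pd dis = go start pd
    where
    start : Disjoint F (N P)
    start {x} x∈F x∈NP with x∈N⁻ {P} x∈NP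
    ... | s , s∈P , inj₁ refl = dis (S⊆N x∈F) s∈P
    ... | s , s∈P , inj₂ x~s = dis (x∈N⁺ x∈F (inj₂ (~-sym x~s))) s∈P

    go : ∀ {A} → Disjoint F A → ¬ Star (_⟶_ G) A ⊤
    go F∩A ε = F∩A f∈F ∈⊤
    go {A} F∩A ((v , w , (v∈A , v~w , w∉A , only-w) , refl) ◅ steps) = go F∩A∪w steps
      where
      w∉F : w ∉ F
      w∉F w∈F = let u , u∈F , u≢w , v~u = fort v w (λ v∈F → F∩A v∈F v∈A) w∈F v~w
                in u≢w (only-w u v~u (F∩A u∈F))

      F∩A∪w : Disjoint F (A ∪ ⁅ w ⁆)
      F∩A∪w x∈F x∈ with x∈p∪q⁻ A ⁅ w ⁆ x∈
      ... | inj₁ x∈A = F∩A x∈F x∈A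
      ... | inj₂ x∈w rewrite x∈⁅y⁆⇒x≡y w x∈w = w∉F x∈F

  -- The complement of the final observed set is a fort, since an observed vertex with exactly one
  -- unobserved neighbour would force it.
  avoiding-fort : ∀ {S} → ¬ PowerDominating G S → ∃ λ F → Fort F × Disjoint (N F) S
  avoiding-fort {S} ¬pd with run G (N S)
  ... | C , steps , stuck with nonempty? (∁ C)
  ...   | no empty = ⊥-elim (¬pd (subst (Star (_⟶_ G) (N S))
            (⊆-antisym ⊆⊤ (λ {x} _ → x∉∁p⇒x∈p λ x∈ → empty (x , x∈))) steps))
  ...   | yes ne = ∁ C , (ne , fort) , dis
    where
    fort : ∀ v u → v ∉ ∁ C → u ∈ ∁ C → v ~ u → ∃ λ u′ → u′ ∈ ∁ C × u′ ≢ u × v ~ u′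
    fort v u v∉ u∈ v~u with any? (λ u′ → (u′ ∈? ∁ C) ×-dec ¬? (u′ ≟ u) ×-dec (v ~? u′))
    ... | yes found = found
    ... | no none = ⊥-elim (stuck v u (x∉∁p⇒x∈p v∉ , v~u , x∈∁p⇒x∉p u∈ , λ u′ v~u′ u′∉C →
            decidable-stable (u′ ≟ u) λ u′≢u → none (u′ , x∉p⇒x∈∁p u′∉C , u′≢u , v~u′)))

    dis : Disjoint (N (∁ C)) S
    dis x∈N x∈S with x∈N⁻ {∁ C} x∈N
    ... | f , f∈ , inj₁ refl = x∈∁p⇒x∉p f∈ (⟶-⊆ G steps (S⊆N x∈S))
    ... | f , f∈ , inj₂ x~f = x∈∁p⇒x∉p f∈ (⟶-⊆ G steps (x∈N⁺ x∈S (inj₂ (~-sym x~f))))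

  -- Extremal forts and the descent through regions.

  record ExtremalFort (S : Subset order) : Set where
    field
      fort     : Subset order
      isFort   : Fort fort
      avoids   : Disjoint (N fort) S
      top      : Vertex
      extremal : ∀ {F} → Fort F → Disjoint (N F) (S ∪ ⁅ top ⁆) → Disjoint (N F) (N fort)

  -- As a neighbour of `g`, `root` is not in `F`, so all neighbours of `F ∩ sub` lie in `sub`. The
  -- second neighbour supplied by `fort` does too: by closedness if `v` is not `root`, by `escape`
  -- if it is.
  fort-∩ : ∀ {g D y F} (s : SubRegion g D y) → Fort F → y ∈ F → g ∉ N F →
           let open SubRegion s in Fort (F ∩ sub) × N (F ∩ sub) ⊆ sub
  fort-∩ {g} {_} {y} {F} s (_ , fort) y∈F g∉N = ((y , x∈p∩q⁺ (y∈F , y∈sub)) , fort′) , N⊆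
    where
    open SubRegion s

    root∉F : root ∉ F
    root∉F c∈F = g∉N (x∈N⁺ c∈F (inj₂ (~-sym root~)))

    nbr : ∀ {f z} → f ∈ F ∩ sub → f ~ z → z ∈ sub
    nbr f∈ f~z = let f∈F , f∈D = x∈p∩q⁻ F sub f∈ in
      closed region f∈D (λ { refl → root∉F f∈F }) f~z

    fort′ : ∀ v u → v ∉ F ∩ sub → u ∈ F ∩ sub → v ~ u → ∃ λ u′ → u′ ∈ F ∩ sub × u′ ≢ u × v ~ u′
    fort′ v u v∉ u∈ v~u with fort v u (λ v∈F → v∉ (x∈p∩q⁺ (v∈F , nbr u∈ (~-sym v~u))))
                                     (proj₁ (x∈p∩q⁻ F sub u∈)) v~u
    ... | u′ , u′∈F , u′≢u , v~u′ = u′ , x∈p∩q⁺ (u′∈F , u′∈sub) , u′≢u , v~u′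
      where
      u′∈sub : u′ ∈ sub
      u′∈sub with v ≟ root
      ... | no v≢c = closed region (nbr u∈ (~-sym v~u)) v≢c v~u′
      ... | yes refl = decidable-stable (u′ ∈? sub) λ u′∉ → outside (escape v~u′ u′∉)
        where
        outside : ¬ (u′ ≡ g ⊎ u′ ~ g)
        outside (inj₁ refl) = g∉N (S⊆N u′∈F)
        outside (inj₂ u′~g) = g∉N (x∈N⁺ u′∈F (inj₂ (~-sym u′~g)))

    N⊆ : N (F ∩ sub) ⊆ sub
    N⊆ x∈ with x∈N⁻ {F ∩ sub} x∈
    ... | f , f∈ , inj₁ refl = proj₂ (x∈p∩q⁻ F sub f∈)
    ... | f , f∈ , inj₂ x~f = nbr f∈ (~-sym x~f)

  N-∩ : ∀ F D → N (F ∩ D) ⊆ N F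
  N-∩ F D x∈ = let f , f∈ , x≈f = x∈N⁻ {F ∩ D} x∈ in x∈N⁺ (proj₁ (x∈p∩q⁻ F D f∈)) x≈f

  -- Descend to a smallest region containing a fort that avoids S.
  extremalFort : BlockGraph G → ∀ {S} → ¬ PowerDominating G S → ExtremalFort S
  extremalFort bg@(((r , _) , _) , _) {S} ¬pd =
    let F , fort , avoids = avoiding-fort ¬pd in
    -- The whole vertex set is a region with any vertex as top.
    go r ⊤ (⊂-wellFounded ⊤) (record { top∈ = ∈⊤ ; closed = λ _ _ _ → ∈⊤ }) F fort avoids ⊆⊤
    where
    go : ∀ g D → Acc _⊂_ D → Region g D →
         ∀ F → Fort F → Disjoint (N F) S → N F ⊆ D → ExtremalFort S
    go g D (acc rs) r F fort avoids N⊆D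
      with anySubset? (λ F′ → fort? F′ ×-dec disjoint? (N F′) S ×-dec ¬? (g ∈? N F′) ×-dec
                               nonempty? (F′ ∩ D))
    ... | yes (F′ , fort′ , avoids′ , g∉N , y , y∈) =
      let y∈F′ , y∈D = x∈p∩q⁻ F′ D y∈
          s = subRegion bg r y∈D (λ { refl → g∉N (S⊆N y∈F′) })
          open SubRegion s
          fort″ , N⊆sub = fort-∩ s fort′ y∈F′ g∉N
      in go root sub (rs (sub⊆ , g , top∈ r , g∉sub)) region (F′ ∩ sub) fort″
            (avoids′ ∘ N-∩ F′ sub) N⊆sub
    ... | no none = record
      { fort = F ; isFort = fort ; avoids = avoids ; top = g
      ; extremal = λ fort′ avoids′ x∈ x∈F → noMeet fort′ avoids′ x∈ (N⊆D x∈F) }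
      where
      -- If `N F′` meets `D` at `x`, then `F′` itself meets `D`: since `x` is not `g`, the
      -- neighbours of `x` lie in `D` too.
      noMeet : ∀ {F′} → Fort F′ → Disjoint (N F′) (S ∪ ⁅ g ⁆) → Disjoint (N F′) D
      noMeet {F′} fort′ avoids′ {x} x∈N x∈D =
        let f , f∈F′ , x≈f = x∈N⁻ {F′} x∈N in
        none (F′ , fort′ , (λ y∈ → avoids′ y∈ ∘ p⊆p∪q ⁅ g ⁆) , g∉N , f , x∈p∩q⁺ (f∈F′ , f∈D x≈f))
        where
        g∉N : g ∉ N F′
        g∉N g∈ = avoids′ g∈ (q⊆p∪q S ⁅ g ⁆ (x∈⁅x⁆ g))

        f∈D : ∀ {f} → x ≡ f ⊎ x ~ f → f ∈ D
        f∈D (inj₁ refl) = x∈D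
        f∈D (inj₂ x~f) = closed r x∈D (λ { refl → g∉N x∈N }) x~f

  -- Lower bound by packing forts.

  robust⇒fort-heavy : ∀ {k M F} → RobustPowerDominating G k M → Fort F →
                      suc k ≤ card (restrict (N F) M)
  robust⇒fort-heavy {k} {M} {F} (k≤M , robust) fort = ≰⇒> λ light →
    -- With at most `k` elements in `N F`, some deletion of exactly `k` removes them all, and no
    -- power dominating set is left.
    let D , N⊑D , D⊑M , eq = ⊑-interpolate (restrict-⊑ (N F) M) light k≤M
        P , pd , P⊆ = robust D D⊑M eq
    in powerDominating-meets-fort fort pd λ {x} x∈N x∈P →
         let 0<M∖D = subst (0 <_) (lookup-zipWith _∸_ x M D)
                       (∈-tabulate⁻ (λ v → 0 <? lookup (M ∖ D) v) (P⊆ x∈P))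
             M≤D = subst (_≤ lookup D x) (lookup-restrict M x∈N) (Pointwise.lookup N⊑D x)
         in <⇒≱ 0<M∖D (≤-reflexive (m≤n⇒m∸n≡0 M≤D))

  γP≤ : ∀ {S} → PowerDominating G S → γP G ≤ ∣ S ∣
  γP≤ = proj₂ (proj₂ (γP-exists G)) _

  -- Each round adds one vertex to `S` and, to `U`, a disjoint closed neighbourhood carrying at
  -- least `k + 1` elements of `M`, until `S` is power dominating.
  robust⇒γP≤ : BlockGraph G → ∀ {k M} → RobustPowerDominating G k M → suc k * γP G ≤ card M
  robust⇒γP≤ bg {k} {M} robust =
    go ⊥ ⊥ (⊃-wellFounded ⊥) (λ _ _ _ → ∉⊥) initially
    where
    initially : suc k * ∣ ⊥ {order} ∣ ≤ card (restrict ⊥ M)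
    initially rewrite ∣⊥∣≡0 order | *-zeroʳ k = z≤n

    -- U is the union of the closed neighbourhoods of the forts that contributed to S.
    go : ∀ S U → Acc _⊃_ S → (∀ {F} → Fort F → Disjoint (N F) S → Disjoint (N F) U) →
         suc k * ∣ S ∣ ≤ card (restrict U M) → suc k * γP G ≤ card M
    go S U (acc rs) avoidsU bound with powerDominating? G S
    ... | yes pd = ≤-trans (*-monoʳ-≤ (suc k) (γP≤ pd)) (≤-trans bound (card-mono (restrict-⊑ U M)))
    ... | no ¬pd = go (S ∪ ⁅ top ⁆) (U ∪ N fort) (rs (x∉p⇒p⊂p∪⁅x⁆ S top∉S)) avoidsU′ bound′
      where
      open ExtremalFort (extremalFort bg ¬pd)

      -- Otherwise `fort` would avoid `S ∪ ⁅ top ⁆`, and `extremal` would make its nonempty closed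
      -- neighbourhood disjoint from itself.
      top∉S : top ∉ S
      top∉S top∈S = let f , f∈ = proj₁ isFort in
        extremal isFort (Disjoint-∪ʳ S ⁅ top ⁆ avoids λ x∈N x∈top →
          avoids x∈N (subst (_∈ S) (sym (x∈⁅y⁆⇒x≡y top x∈top)) top∈S)) (S⊆N f∈) (S⊆N f∈)

      avoidsU′ : ∀ {F} → Fort F → Disjoint (N F) (S ∪ ⁅ top ⁆) → Disjoint (N F) (U ∪ N fort)
      avoidsU′ isF avoidsS = Disjoint-∪ʳ U (N fort)
        (avoidsU isF λ x∈N → avoidsS x∈N ∘ p⊆p∪q ⁅ top ⁆) (extremal isF avoidsS)

      bound′ : suc k * ∣ S ∪ ⁅ top ⁆ ∣ ≤ card (restrict (U ∪ N fort) M)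
      bound′ = begin
        suc k * ∣ S ∪ ⁅ top ⁆ ∣
          ≤⟨ *-monoʳ-≤ (suc k) (∣p∪q∣≤∣p∣+∣q∣ S ⁅ top ⁆) ⟩
        suc k * (∣ S ∣ + ∣ ⁅ top ⁆ ∣)
          ≡⟨ cong (λ m → suc k * (∣ S ∣ + m)) (∣⁅x⁆∣≡1 top) ⟩
        suc k * (∣ S ∣ + 1)
          ≡⟨ *-distribˡ-+ (suc k) ∣ S ∣ 1 ⟩
        suc k * ∣ S ∣ + suc k * 1
          ≡⟨ cong (suc k * ∣ S ∣ +_) (*-identityʳ (suc k)) ⟩
        suc k * ∣ S ∣ + suc k
          ≤⟨ +-mono-≤ bound (robust⇒fort-heavy robust isFort) ⟩
        card (restrict U M) + card (restrict (N fort) M)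
          ≡⟨ card-restrict-∪ U (N fort) M (λ x∈U x∈N → avoidsU isFort avoids x∈N x∈U) ⟨
        card (restrict (U ∪ N fort) M)
          ∎
        where open ≤-Reasoning

  -- Upper bound by repeating a power dominating set.

  powerDominating⇒nonempty : ∀ {S} → Vertex → PowerDominating G S → Nonempty S
  powerDominating⇒nonempty {S} v pd = decidable-stable (nonempty? S) λ empty →
    -- The whole vertex set is vacuously a fort.
    powerDominating-meets-fort {F = ⊤} ((v , ∈⊤) , λ _ _ v∉ → ⊥-elim (v∉ ∈⊤)) pd
      λ _ x∈S → empty (_ , x∈S)

  -- Deleting `k` elements cannot exhaust the `k + 1` copies of any vertex of `S`. Nonemptiness of
  -- `S` ensures that there are `k` elements to delete.
  copies-robust : ∀ {S} k → Vertex → PowerDominating G S →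
                  RobustPowerDominating G k (restrict S (replicate order (suc k)))
  copies-robust {S} k v pd = k≤card , λ F _ eq → S , pd ,
    λ x∈S → ∈-tabulate⁺ (λ x → 0 <? lookup (M ∖ F) x) (left F eq x∈S)
    where
    M = restrict S (replicate order (suc k))

    x∈S = proj₂ (powerDominating⇒nonempty v pd)

    k≤card : k ≤ card M
    k≤card = begin
      k             ≤⟨ n≤1+n k ⟩
      suc k         ≡⟨ *-identityʳ (suc k) ⟨
      suc k * 1     ≤⟨ *-monoʳ-≤ (suc k) (≤-<-trans z≤n (x∈p⇒∣p-x∣<∣p∣ x∈S)) ⟩
      suc k * ∣ S ∣ ≡⟨ card-restrict-replicate (suc k) S ⟨
      card M        ∎
      where open ≤-Reasoning

    left : ∀ F → card F ≡ k → ∀ {x} → x ∈ S → 0 < lookup (M ∖ F) x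
    left F eq {x} x∈S
      rewrite lookup-zipWith _∸_ x M F | lookup-restrict (replicate order (suc k)) x∈S
            | lookup-replicate x (suc k) =
      m<n⇒0<n∸m (s≤s (subst (lookup F x ≤_) (lookup-replicate x k)
        (Pointwise.lookup (⊑-replicate-card F (≤-reflexive eq)) x)))

theorem6 : (G : Graph) → BlockGraph G → (k : ℕ) → γrP k G ≡ (k + 1) * γP G
theorem6 G bg@(((v , _) , _) , _) k =
  let (S , pd , ∣S∣≡) , _ = proj₂ (γP-exists G)
      (M , robust , card≡) , minimal = proj₂ (γrP-exists k G)
  in trans (≤-antisym
       (begin
         γrP k G                                              ≤⟨ minimal _ (copies-robust G k v pd) ⟩
         card (restrict S (replicate (Graph.order G) (suc k))) ≡⟨ card-restrict-replicate (suc k) S ⟩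
         suc k * ∣ S ∣                                        ≡⟨ cong (suc k *_) ∣S∣≡ ⟩
         suc k * γP G                                         ∎)
       (≤-trans (robust⇒γP≤ G bg robust) (≤-reflexive card≡)))
     (cong (_* γP G) (+-comm 1 k))
  where open ≤-Reasoning
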